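{- Let $n\geq 2$, let $a,b$ be integers with $1\leq a<b\leq n$, and let $\sigma$ be an $(n-1)$-permutation. Then there exists a u-p-word for $n$-permutations of the form $\Diamond_{a,b}u_2u_3\cdots u_N$ with $\mathrm{red}(u_2u_3\cdots u_n)=\sigma$ if and only if either ($a=1$ and $\sigma=12\cdots(n-1)$) or ($b=n$ and $\sigma=(n-1)(n-2)\cdots 1$).
   Context: An $n$-permutation is a permutation $\pi_1\cdots\pi_n$ of $\{1,\ldots,n\}$. For a word $w$ of distinct numbers, $\mathrm{red}(w)$ is obtained by replacing the $i$-th smallest letter by $i$. For integers $1\leq a<b\leq n$, $\Diamond_{a,b}$ is a restricted wildcard symbol. Consider a word $u=\Diamond_{a,b}u_2u_3\cdots u_N$ with $N\geq n$ and $u_2,\ldots,u_N$ positive integers. Its factors of length $n$ are $u_iu_{i+1}\cdots u_{i+n-1}$ for $1\leq i\leq N-n+1$ (with $u_1=\Diamond_{a,b}$); each factor's integer letters must be pairwise distinct. The first factor $\Diamond_{a,b}u_2\cdots u_n$ covers exactly the $n$-permutations $\pi$ with $\pi_1\in\{a,b\}$ and $\mathrm{red}(\pi_2\cdots\pi_n)=\mathrm{red}(u_2\cdots u_n)$ (i.e., the wildcard is replaced by a value that becomes the $a$-th or $b$-th smallest entry); a factor $u_i\cdots u_{i+n-1}$ with $i\geq 2$ covers only the $n$-permutation $\mathrm{red}(u_i\cdots u_{i+n-1})$. Such a word is a u-p-word for $n$-permutations if every $n$-permutation is covered by exactly one of its length-$n$ factors. -}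

module Defs where

open import Data.Nat using (ℕ; zero; suc; _+_; _∸_; _≤_; _<?_)
open import Data.List using (List; []; _∷_; length; map; filter; take; drop; applyUpTo; applyDownFrom)
open import Data.List.Relation.Unary.All using (All)
open import Data.List.Relation.Unary.Unique.Propositional using (Unique)
open import Data.List.Relation.Binary.Permutation.Propositional using (_↭_)
open import Data.Product using (_×_; ∃!)
open import Data.Sum using (_⊎_)
open import Data.Empty using (⊥)
open import Relation.Binary.PropositionalEquality using (_≡_)

-- 1 2 ⋯ n
increasing : ℕ → List ℕ
increasing n = applyUpTo suc n

-- n (n-1) ⋯ 1
decreasing : ℕ → List ℕ
decreasing n = applyDownFrom suc n

-- Permutations are in one-line notation, with letters 1, …, n.
IsPermutation : ℕ → List ℕ → Set
IsPermutation n π = π ↭ increasing n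

-- In a word with distinct letters, x is the i-th smallest letter exactly when
-- i - 1 letters are smaller than x.
rank : List ℕ → ℕ → ℕ
rank w x = suc (length (filter (_<? x) w))

red : List ℕ → List ℕ
red w = map (rank w) w

-- A factor of ◇_{a,b} u₂ u₃ ⋯ u_N either begins with the wildcard or consists
-- of integers only.
data Factor : Set where
  ◇⟨_,_⟩∷_ : (a b : ℕ) → List ℕ → Factor
  plain    : List ℕ → Factor

integerLetters : Factor → List ℕ
integerLetters (◇⟨ a , b ⟩∷ v) = v
integerLetters (plain v)       = v

Covers : Factor → List ℕ → Set
Covers (◇⟨ a , b ⟩∷ v) []      = ⊥
Covers (◇⟨ a , b ⟩∷ v) (x ∷ π) = (x ≡ a ⊎ x ≡ b) × red π ≡ red v
Covers (plain v)       π       = π ≡ red v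

-- The word ◇_{a,b} u₂ u₃ ⋯ u_N is given by a, b and the list us = u₂ u₃ ⋯ u_N,
-- so N = 1 + length us.  Positions are counted from 0: position 0 holds the
-- wildcard and position 1 + i holds the entry of us with index i.
factor : (n a b : ℕ) → List ℕ → ℕ → Factor
factor n a b us zero    = ◇⟨ a , b ⟩∷ take (n ∸ 1) us
factor n a b us (suc i) = plain (take n (drop i us))

IsFactorPosition : ℕ → List ℕ → ℕ → Set
IsFactorPosition n us i = i + n ≤ suc (length us)

record IsUPWord (n a b : ℕ) (us : List ℕ) : Set where
  field
    positive : All (1 ≤_) us
    long     : n ≤ suc (length us)
    distinct : ∀ i → IsFactorPosition n us i →
               Unique (integerLetters (factor n a b us i))
    covering : ∀ π → IsPermutation n π →
               ∃! _≡_ λ i → IsFactorPosition n us i × Covers (factor n a b us i) π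

{-# OPTIONS --safe #-}
-- Let the (n-1)-permutations be vertices and every n-permutation π an edge from
-- red(π₁⋯πₙ₋₁) to red(π₂⋯πₙ); every vertex has n entering and n leaving edges.
-- Write kv for the edge into v with first letter k.  A u-p-word starting with σ is
-- an Eulerian trail from σ in this graph without the edges aσ and bσ, which the
-- wildcard covers.
--
-- If neither removed edge is a loop, the trail leaves σ n times but can arrive
-- there at most (n-2)+1 times.  A loop is a monotone n-permutation.
--
-- Conversely, remove a loop ℓσ with ℓ ∈ {1, n} and one further edge into σ, and
-- walk backwards from the start of the latter along unused edges, entering each
-- vertex v ≠ σ by the edge ℓv last.  By balance the walk can only get stuck at σ.
-- Exhaustion of a vertex propagates along the edges ℓv, and since prepending n-1
-- extremal letters turns every vertex into σ, all edges have been used.  Going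
-- backwards, a letter of any prescribed rank can be prepended by doubling the
-- word and taking an odd letter.
module Submission where

open import Data.Bool using (Bool; true; false; if_then_else_)
open import Data.Fin using (Fin; toℕ; fromℕ<; punchOut)
open import Data.Fin.Properties using (toℕ<n; toℕ-fromℕ<; toℕ-injective; any?; punchOut-injective; injective⇒≤)
open import Data.List using (List; []; _∷_; [_]; _++_; _∷ʳ_; length; map; take; drop; concatMap; deduplicate; initLast; _∷ʳ′_)
open import Data.List.Membership.Propositional using (_∈_; _∉_; find; lose)
open import Data.List.Membership.Propositional.Properties using (∈-map⁺; ∈-map⁻; ∈-∃++; ∈-concatMap⁺; ∈-concatMap⁻; ∈-deduplicate⁺; ∈-deduplicate⁻; ∈-applyUpTo⁺; ∈-applyUpTo⁻)
open import Data.List.Membership.Propositional.Properties.WithK using (unique∧set⇒bag)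
open import Data.List.Properties using (≡-dec; ∷-injective; ∷-injectiveˡ; ∷ʳ-injective; ∷ʳ-injectiveʳ; map-∘; map-id; map-cong; map-cong-local; map-id-local; map-applyUpTo; length-++; length-map; length-take; length-drop; length-filter; length-applyUpTo; length-applyDownFrom; take-take; take-map; take-all; drop-map; filter-accept; filter-reject; filter-all; filter-none)
open import Data.List.Relation.Binary.BagAndSetEquality using (∼bag⇒↭)
open import Data.List.Relation.Binary.Permutation.Propositional using (_↭_; ↭-refl; ↭-sym; ↭-trans; ↭-reflexive; ↭-prep; ↭-swap; ↭⇒↭ₛ; module PermutationReasoning)
open import Data.List.Relation.Binary.Permutation.Propositional.Properties using (map⁺; ↭-length; filter-↭; ∈-resp-↭; ∷↭∷ʳ) renaming (shift to ↭-shift)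
import Data.List.Relation.Binary.Permutation.Setoid.Properties as SetoidPermutation
open import Data.List.Relation.Unary.All as All using (All; []; _∷_)
import Data.List.Relation.Unary.All.Properties as All
open import Data.List.Relation.Unary.AllPairs as AllPairs using (AllPairs; []; _∷_)
import Data.List.Relation.Unary.AllPairs.Properties as AllPairs
open import Data.List.Relation.Unary.Any as Any using (here; there)
open import Data.List.Relation.Unary.Linked using (Linked; []; [-]; _∷_)
open import Data.List.Relation.Unary.Linked.Properties using (Linked⇒AllPairs)
open import Data.List.Relation.Unary.Unique.DecPropositional.Properties using (deduplicate-!)
open import Data.List.Relation.Unary.Unique.Propositional using (Unique)
open import Data.List.Relation.Unary.Unique.Propositional.Properties as Unique using (Unique[x∷xs]⇒x∉xs)
open import Data.Nat using (ℕ; zero; suc; _+_; _∸_; _≤_; _<_; _<?_; z≤n; s≤s; z<s; s<s)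
open import Data.Nat.ListAction using (sum)
open import Data.Nat.ListAction.Properties using (sum-↭)
open import Data.Nat.Properties
open import Data.Product using (_×_; _,_; proj₁; proj₂; ∃-syntax)
open import Data.Sum as Sum using (_⊎_; inj₁; inj₂; [_,_]′; swap)
open import Function using (_∘_; id; flip)
open import Function.Bundles using (_⇔_; mk⇔; Equivalence)
open import Relation.Binary.Definitions using (DecidableEquality; tri<; tri≈; tri>)
open import Relation.Binary.PropositionalEquality using (_≡_; _≢_; refl; sym; trans; cong; cong₂; subst; subst₂; setoid; module ≡-Reasoning)
open import Relation.Nullary using (yes; no; ¬_; ¬?; contradiction; does; _×-dec_)
open import Relation.Nullary.Decidable using (does-⇔; dec-true; dec-false)
open import Defs

-- Ranks and reductions

Unique-resp-↭ : {A : Set} {xs ys : List A} → xs ↭ ys → Unique xs → Unique ys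
Unique-resp-↭ {A} xs↭ys = SetoidPermutation.Unique-resp-↭ (setoid A) (↭⇒↭ₛ xs↭ys)

rank-∷-< : ∀ {x y} w → x < y → rank (x ∷ w) y ≡ suc (rank w y)
rank-∷-< {y = y} w x<y = cong (suc ∘ length) (filter-accept (_<? y) x<y)

rank-∷-≮ : ∀ {x y} w → ¬ x < y → rank (x ∷ w) y ≡ rank w y
rank-∷-≮ {y = y} w x≮y = cong (suc ∘ length) (filter-reject (_<? y) x≮y)

rank-mono-≤ : ∀ w {x y} → x ≤ y → rank w x ≤ rank w y
rank-mono-≤ []      x≤y = ≤-refl
rank-mono-≤ (z ∷ w) {x} {y} x≤y with z <? x | z <? y
... | yes z<x | yes z<y = subst₂ _≤_ (sym (rank-∷-< w z<x)) (sym (rank-∷-< w z<y)) (s≤s (rank-mono-≤ w x≤y))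
... | yes z<x | no  z≮y = contradiction (<-≤-trans z<x x≤y) z≮y
... | no  z≮x | yes z<y = subst₂ _≤_ (sym (rank-∷-≮ w z≮x)) (sym (rank-∷-< w z<y)) (m≤n⇒m≤1+n (rank-mono-≤ w x≤y))
... | no  z≮x | no  z≮y = subst₂ _≤_ (sym (rank-∷-≮ w z≮x)) (sym (rank-∷-≮ w z≮y)) (rank-mono-≤ w x≤y)

-- Strictness comes from the letter `x` itself, which is counted below `y` but not below `x`.
rank-mono-< : ∀ {w x y} → x ∈ w → x < y → rank w x < rank w y
rank-mono-< {z ∷ w} (here refl) x<y =
  subst₂ _<_ (sym (rank-∷-≮ w (<-irrefl refl))) (sym (rank-∷-< w x<y)) (s≤s (rank-mono-≤ w (<⇒≤ x<y)))
rank-mono-< {z ∷ w} {x} {y} (there x∈w) x<y with z <? x | z <? y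
... | yes z<x | yes z<y = subst₂ _<_ (sym (rank-∷-< w z<x)) (sym (rank-∷-< w z<y)) (s<s (rank-mono-< x∈w x<y))
... | yes z<x | no  z≮y = contradiction (<-trans z<x x<y) z≮y
... | no  z≮x | yes z<y = subst₂ _<_ (sym (rank-∷-≮ w z≮x)) (sym (rank-∷-< w z<y)) (m<n⇒m<1+n (rank-mono-< x∈w x<y))
... | no  z≮x | no  z≮y = subst₂ _<_ (sym (rank-∷-≮ w z≮x)) (sym (rank-∷-≮ w z≮y)) (rank-mono-< x∈w x<y)

rank-cancel-< : ∀ w {x y} → rank w x < rank w y → x < y
rank-cancel-< w r<r = ≰⇒> λ y≤x → ≤⇒≯ (rank-mono-≤ w y≤x) r<r

rank≤ : ∀ w x → rank w x ≤ suc (length w)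
rank≤ w x = s≤s (length-filter (_<? x) w)

rank-↭ : ∀ {w w′} → w ↭ w′ → ∀ x → rank w x ≡ rank w′ x
rank-↭ w↭w′ x = cong suc (↭-length (filter-↭ (_<? x) w↭w′))

rank-minimum : ∀ {w x} → All (x <_) w → rank w x ≡ 1
rank-minimum x<w = cong (suc ∘ length) (filter-none _ (All.map <-asym x<w))

rank-maximum : ∀ {w x} → All (_< x) w → rank w x ≡ suc (length w)
rank-maximum w<x = cong (suc ∘ length) (filter-all _ w<x)

rank-map-cong : ∀ {A : Set} (f g : A → ℕ) z x → (∀ {y} → y ∈ z → f y < f x ⇔ g y < g x) →
                rank (map f z) (f x) ≡ rank (map g z) (g x)
rank-map-cong f g []      x iso = refl
rank-map-cong f g (y ∷ z) x iso with f y <? f x | rank-map-cong f g z x (iso ∘ there)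
... | yes fy<fx | ih = trans (rank-∷-< (map f z) fy<fx)
    (trans (cong suc ih) (sym (rank-∷-< (map g z) (Equivalence.to (iso (here refl)) fy<fx))))
... | no  fy≮fx | ih = trans (rank-∷-≮ (map f z) fy≮fx)
    (trans ih (sym (rank-∷-≮ (map g z) (fy≮fx ∘ Equivalence.from (iso (here refl))))))

-- Ranks depend only on comparisons. Writing both words as images of one list `z` matches their
-- letters position by position.
red-map-cong : ∀ {A : Set} (f g : A → ℕ) z →
               (∀ {x y} → x ∈ z → y ∈ z → f x < f y ⇔ g x < g y) → red (map f z) ≡ red (map g z)
red-map-cong f g z iso = begin
  map (rank (map f z)) (map f z)  ≡⟨ map-∘ z ⟨
  map (rank (map f z) ∘ f) z      ≡⟨ map-cong-local (All.tabulate λ {x} x∈z → rank-map-cong f g z x λ y∈z → iso y∈z x∈z) ⟩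
  map (rank (map g z) ∘ g) z      ≡⟨ map-∘ z ⟩
  map (rank (map g z)) (map g z)  ∎
  where open ≡-Reasoning

red-map : ∀ (f : ℕ → ℕ) {w} → (∀ {x y} → x ∈ w → y ∈ w → f x < f y ⇔ x < y) → red (map f w) ≡ red w
red-map f {w} iso = trans (red-map-cong f id w iso) (cong red (map-id w))

rank-< : ∀ w {x y} → x ∈ w → rank w x < rank w y ⇔ x < y
rank-< w x∈w = mk⇔ (rank-cancel-< w) (rank-mono-< x∈w)

take⊆ : ∀ {A : Set} {x : A} m {w} → x ∈ take m w → x ∈ w
take⊆ (suc m) {_ ∷ w} (here eq)  = here eq
take⊆ (suc m) {_ ∷ w} (there x∈) = there (take⊆ m x∈)

-- `rank w` preserves and reflects the order of the letters of `w`. Hence the source of the edge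
-- `red w` can be read off `w` directly.
red-take-red : ∀ m w → red (take m (red w)) ≡ red (take m w)
red-take-red m w = trans (cong red (take-map m w)) (red-map (rank w) λ x∈ _ → rank-< w (take⊆ m x∈))

red-tail-red : ∀ w → red (drop 1 (red w)) ≡ red (drop 1 w)
red-tail-red []      = refl
red-tail-red (x ∷ w) = red-map (rank (x ∷ w)) λ x∈ _ → rank-< (x ∷ w) (there x∈)

-- Inserting a first or last letter into a permutation

shift : ℕ → ℕ → ℕ
shift k x with x <? k
... | yes _ = x
... | no  _ = suc x

shift-< : ∀ {k x} → x < k → shift k x ≡ x
shift-< {k} {x} x<k with x <? k
... | yes _   = refl
... | no  x≮k = contradiction x<k x≮k

shift-≥ : ∀ {k x} → k ≤ x → shift k x ≡ suc x
shift-≥ {k} {x} k≤x with x <? k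
... | yes x<k = contradiction x<k (≤⇒≯ k≤x)
... | no  _   = refl

shift-suc : ∀ k x → shift (suc k) (suc x) ≡ suc (shift k x)
shift-suc k x with x <? k
... | yes x<k = shift-< (s<s x<k)
... | no  x≮k = shift-≥ (s≤s (≮⇒≥ x≮k))

shift-mono-< : ∀ k {x y} → x < y → shift k x < shift k y
shift-mono-< k {x} {y} x<y with x <? k | y <? k
... | yes _   | yes _   = x<y
... | yes _   | no  _   = m<n⇒m<1+n x<y
... | no  x≮k | yes y<k = contradiction (<-trans x<y y<k) x≮k
... | no  _   | no  _   = s<s x<y

strictMono⇔ : ∀ (f : ℕ → ℕ) → (∀ {x y} → x < y → f x < f y) → ∀ {x y} → f x < f y ⇔ x < y
strictMono⇔ f mono {x} {y} = mk⇔ cancel mono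
  where
  cancel : f x < f y → x < y
  cancel fx<fy with <-cmp x y
  ... | tri< x<y _    _   = x<y
  ... | tri≈ _   refl _   = contradiction fx<fy (<-irrefl refl)
  ... | tri> _   _    y<x = contradiction fx<fy (<-asym (mono y<x))

red-map-mono : ∀ (f : ℕ → ℕ) → (∀ {x y} → x < y → f x < f y) → ∀ w → red (map f w) ≡ red w
red-map-mono f mono w = red-map f {w} λ _ _ → strictMono⇔ f mono

-- This is the edge into the vertex `v` written kv in the overview; `shift k` is the increasing map
-- that skips the value `k`.
prepend : ℕ → List ℕ → List ℕ
prepend k v = k ∷ map (shift k) v

append : ℕ → List ℕ → List ℕ
append k v = map (shift k) v ∷ʳ k

increasing-suc : ∀ n → increasing (suc n) ≡ 1 ∷ map suc (increasing n)
increasing-suc n = cong (1 ∷_) (sym (map-applyUpTo suc suc n))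

increasing-positive : ∀ n → All (1 ≤_) (increasing n)
increasing-positive n = All.applyUpTo⁺₂ suc n λ _ → s≤s z≤n

prepend-1-increasing : ∀ n → prepend 1 (increasing n) ≡ increasing (suc n)
prepend-1-increasing n = cong (1 ∷_)
  (trans (map-cong-local (All.map shift-≥ (increasing-positive n))) (map-applyUpTo suc suc n))

-- For `k` above 1 the letter 1 is moved to the front; what follows is the `suc`-image of the case
-- with `n` and `k` both lowered by one.
prepend-increasing : ∀ n {k} → 1 ≤ k → k ≤ suc n → prepend k (increasing n) ↭ increasing (suc n)
prepend-increasing n {suc zero} _ _ = ↭-reflexive (prepend-1-increasing n)
prepend-increasing (suc n) {suc (suc k)} _ (s≤s k≤n) = begin
  2+k ∷ map (shift 2+k) (increasing (suc n))
    ≡⟨ cong (prepend 2+k) (increasing-suc n) ⟩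
  2+k ∷ 1 ∷ map (shift 2+k) (map suc (increasing n))
    ≡⟨ cong (λ w → 2+k ∷ 1 ∷ w) (map-∘ (increasing n)) ⟨
  2+k ∷ 1 ∷ map (shift 2+k ∘ suc) (increasing n)
    ≡⟨ cong (λ w → 2+k ∷ 1 ∷ w) (trans (map-cong (shift-suc (suc k)) (increasing n)) (map-∘ (increasing n))) ⟩
  2+k ∷ 1 ∷ map suc (map (shift (suc k)) (increasing n))
    ↭⟨ ↭-swap 2+k 1 ↭-refl ⟩
  1 ∷ map suc (prepend (suc k) (increasing n))
    ↭⟨ ↭-prep 1 (map⁺ suc (prepend-increasing n (s≤s z≤n) k≤n)) ⟩
  1 ∷ map suc (increasing (suc n))
    ≡⟨ increasing-suc (suc n) ⟨
  increasing (suc (suc n)) ∎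
  where open PermutationReasoning
        2+k = suc (suc k)

prepend-perm : ∀ {n v k} → IsPermutation n v → 1 ≤ k → k ≤ suc n → IsPermutation (suc n) (prepend k v)
prepend-perm {n} {v} {k} v-perm 1≤k k≤ =
  ↭-trans (↭-prep k (map⁺ (shift k) v-perm)) (prepend-increasing n 1≤k k≤)

append-perm : ∀ {n v k} → IsPermutation n v → 1 ≤ k → k ≤ suc n → IsPermutation (suc n) (append k v)
append-perm {n} {v} {k} v-perm 1≤k k≤ =
  ↭-trans (↭-sym (∷↭∷ʳ k (map (shift k) v))) (prepend-perm v-perm 1≤k k≤)

-- A later letter gains one in rank exactly when it exceeds `x`, that is, when its rank in `w` is at
-- least that of `x`.
red-∷ : ∀ {x w} → Unique (x ∷ w) → red (x ∷ w) ≡ prepend (rank w x) (red w)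
red-∷ {x} {w} (x∉ ∷ _) = cong₂ _∷_ (rank-∷-≮ w (<-irrefl refl))
  (trans (map-cong-local (All.tabulate shifted)) (map-∘ w))
  where
  shifted : ∀ {y} → y ∈ w → rank (x ∷ w) y ≡ shift (rank w x) (rank w y)
  shifted {y} y∈w with <-cmp x y
  ... | tri< x<y _ _   = trans (rank-∷-< w x<y) (sym (shift-≥ (rank-mono-≤ w (<⇒≤ x<y))))
  ... | tri≈ _ x≡y _   = contradiction x≡y (All.lookup x∉ y∈w)
  ... | tri> x≮y _ y<x = trans (rank-∷-≮ w x≮y) (sym (shift-< (rank-mono-< y∈w y<x)))

red-perm : ∀ w → Unique w → IsPermutation (length w) (red w)
red-perm []      _                  = ↭-refl
red-perm (x ∷ w) u@(_ ∷ w-unique) = subst (IsPermutation (suc (length w))) (sym (red-∷ u))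
  (prepend-perm (red-perm w w-unique) (s≤s z≤n) (rank≤ w x))

perm-length : ∀ {n π} → IsPermutation n π → length π ≡ n
perm-length {n} π-perm = trans (↭-length π-perm) (length-applyUpTo suc n)

perm-unique : ∀ {n π} → IsPermutation n π → Unique π
perm-unique {n} π-perm = Unique-resp-↭ (↭-sym π-perm)
  (AllPairs.applyUpTo⁺₁ suc n λ i<j _ → <⇒≢ (s<s i<j))

∈-perm⁻ : ∀ {n π x} → IsPermutation n π → x ∈ π → 1 ≤ x × x ≤ n
∈-perm⁻ π-perm x∈π with ∈-applyUpTo⁻ suc (∈-resp-↭ π-perm x∈π)
... | _ , i<n , refl = s≤s z≤n , i<n

∈-perm⁺ : ∀ {n π x} → IsPermutation n π → 1 ≤ x → x ≤ n → x ∈ π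
∈-perm⁺ {x = suc i} π-perm _ i<n = ∈-resp-↭ (↭-sym π-perm) (∈-applyUpTo⁺ suc i<n)

rank-increasing : ∀ n {i} → i ≤ n → rank (increasing n) (suc i) ≡ suc i
rank-increasing n {zero} _ = cong (suc ∘ length) (filter-none _ (All.map ≤⇒≯ (increasing-positive n)))
rank-increasing (suc n) {suc i} (s≤s i≤n) = begin
  rank (increasing (suc n)) (2 + i)               ≡⟨ cong (λ w → rank w (2 + i)) (increasing-suc n) ⟩
  rank (1 ∷ map suc (increasing n)) (2 + i)       ≡⟨ rank-∷-< {1} (map suc (increasing n)) (s<s z<s) ⟩
  suc (rank (map suc (increasing n)) (2 + i))     ≡⟨ cong suc (rank-map-cong suc id (increasing n) (suc i)
                                                            λ _ → strictMono⇔ suc s<s) ⟩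
  suc (rank (map id (increasing n)) (suc i))      ≡⟨ cong (λ w → suc (rank w (suc i))) (map-id (increasing n)) ⟩
  suc (rank (increasing n) (suc i))               ≡⟨ cong suc (rank-increasing n i≤n) ⟩
  2 + i                                           ∎
  where open ≡-Reasoning

-- Ranks do not change when the word is rearranged, so they may be computed in `increasing n`.
red-of-perm : ∀ {n π} → IsPermutation n π → red π ≡ π
red-of-perm {n} {π} π-perm = map-id-local (All.tabulate fixed)
  where
  fixed : ∀ {x} → x ∈ π → rank π x ≡ x
  fixed {x} x∈π with ∈-applyUpTo⁻ suc (∈-resp-↭ π-perm x∈π)
  ... | i , i<n , refl = trans (rank-↭ π-perm x) (rank-increasing n (<⇒≤ i<n))

perm-uncons : ∀ {n k π} → IsPermutation (suc n) (k ∷ π) → k ∷ π ≡ prepend k (red π) × IsPermutation n (red π)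
perm-uncons {n} {k} {π} p = eq , subst (λ m → IsPermutation m (red π)) (suc-injective (perm-length p)) (red-perm π π-unique)
  where
  π-unique : Unique π
  π-unique with perm-unique p
  ... | _ ∷ u = u
  eq′ : k ∷ π ≡ prepend (rank π k) (red π)
  eq′ = trans (sym (red-of-perm p)) (red-∷ (perm-unique p))
  eq : k ∷ π ≡ prepend k (red π)
  eq with rank π k | eq′
  ... | _ | e with ∷-injective e
  ...   | refl , _ = e

red-tail-prepend : ∀ k {n v} → IsPermutation n v → red (drop 1 (prepend k v)) ≡ v
red-tail-prepend k {v = v} v-perm = trans (red-map-mono (shift k) (shift-mono-< k) v) (red-of-perm v-perm)

-- Monotone words and loops

prepend-decreasing : ∀ n → prepend (suc n) (decreasing n) ≡ decreasing (suc n)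
prepend-decreasing n = cong (suc n ∷_) (map-id-local (All.applyDownFrom⁺₁ suc n λ i<n → shift-< (s<s i<n)))

red-ascending : ∀ {w} → AllPairs _<_ w → red w ≡ increasing (length w)
red-ascending []                     = refl
red-ascending {_ ∷ w} w↑@(x<w ∷ w′↑) = begin
  red (_ ∷ w)                      ≡⟨ red-∷ (AllPairs.map <⇒≢ w↑) ⟩
  prepend (rank w _) (red w)       ≡⟨ cong₂ prepend (rank-minimum x<w) (red-ascending w′↑) ⟩
  prepend 1 (increasing (length w)) ≡⟨ prepend-1-increasing (length w) ⟩
  increasing (suc (length w))      ∎
  where open ≡-Reasoning

red-descending : ∀ {w} → AllPairs (flip _<_) w → red w ≡ decreasing (length w)
red-descending []                     = refl
red-descending {_ ∷ w} w↓@(w<x ∷ w′↓) = begin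
  red (_ ∷ w)                                     ≡⟨ red-∷ (AllPairs.map >⇒≢ w↓) ⟩
  prepend (rank w _) (red w)                      ≡⟨ cong₂ prepend (rank-maximum w<x) (red-descending w′↓) ⟩
  prepend (suc (length w)) (decreasing (length w)) ≡⟨ prepend-decreasing (length w) ⟩
  decreasing (suc (length w))                     ∎
  where open ≡-Reasoning

-- The pattern of ascents survives reduction, so it can be compared between overlapping windows.
ascents : List ℕ → List Bool
ascents (x ∷ y ∷ w) = does (x <? y) ∷ ascents (y ∷ w)
ascents _           = []

ascents-map : ∀ (f : ℕ → ℕ) w → (∀ {x y} → x ∈ w → y ∈ w → f x < f y ⇔ x < y) → ascents (map f w) ≡ ascents w
ascents-map f []          iso = refl
ascents-map f (x ∷ [])    iso = refl
ascents-map f (x ∷ y ∷ w) iso = cong₂ _∷_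
  (does-⇔ (iso (here refl) (there (here refl))) (f x <? f y) (x <? y))
  (ascents-map f (y ∷ w) λ x∈ y∈ → iso (there x∈) (there y∈))

ascents-red : ∀ w → ascents (red w) ≡ ascents w
ascents-red w = ascents-map (rank w) w λ x∈w _ → rank-< w x∈w

ascents-take : ∀ m w → ascents (take (suc m) w) ≡ take m (ascents w)
ascents-take zero    []          = refl
ascents-take zero    (x ∷ [])    = refl
ascents-take zero    (x ∷ y ∷ w) = refl
ascents-take (suc m) []          = refl
ascents-take (suc m) (x ∷ [])    = refl
ascents-take (suc m) (x ∷ y ∷ w) = cong (does (x <? y) ∷_) (ascents-take m (y ∷ w))

length-ascents : ∀ x w → length (ascents (x ∷ w)) ≡ length w
length-ascents x []      = refl
length-ascents x (y ∷ w) = cong suc (length-ascents y w)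

-- Each entry of `ds` equals the entry before it in `d ∷ ds`, so the value `d` spreads along the
-- list.
constant-if-shift-invariant : ∀ {A : Set} (d : A) ds → take (length ds) (d ∷ ds) ≡ ds → All (_≡ d) ds
constant-if-shift-invariant d []        eq = []
constant-if-shift-invariant d (d′ ∷ ds) eq with refl , eq′ ← ∷-injective eq =
  refl ∷ constant-if-shift-invariant d ds eq′

all-ascents⇒ascending : ∀ w → All (_≡ true) (ascents w) → Linked _<_ w
all-ascents⇒ascending []          _ = []
all-ascents⇒ascending (x ∷ [])    _ = [-]
all-ascents⇒ascending (x ∷ y ∷ w) (eq ∷ eqs) with x <? y
... | yes x<y = x<y ∷ all-ascents⇒ascending (y ∷ w) eqs
... | no  x≮y = contradiction (trans (sym eq) (dec-false (x <? y) x≮y)) λ ()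

no-ascents⇒descending : ∀ w → Unique w → All (_≡ false) (ascents w) → Linked (flip _<_) w
no-ascents⇒descending []          _ _ = []
no-ascents⇒descending (x ∷ [])    _ _ = [-]
no-ascents⇒descending (x ∷ y ∷ w) ((x≢y ∷ _) ∷ u) (eq ∷ eqs) with x <? y
... | yes x<y = contradiction (trans (sym eq) (dec-true (x <? y) x<y)) λ ()
... | no  x≮y = ≤∧≢⇒< (≮⇒≥ x≮y) (x≢y ∘ sym) ∷ no-ascents⇒descending (y ∷ w) u eqs

-- Equal reductions of the two windows make the ascent pattern invariant under a shift, hence
-- constant.
loop-monotone : ∀ w → Unique w → red (take (length w ∸ 1) w) ≡ red (drop 1 w) →
                AllPairs _<_ w ⊎ AllPairs (flip _<_) w
loop-monotone []          u loop = inj₁ []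
loop-monotone (x ∷ [])    u loop = inj₁ ([] ∷ [])
loop-monotone (x ∷ y ∷ w) u loop
  with does (x <? y) in eq | constant-if-shift-invariant (does (x <? y)) (ascents (y ∷ w)) shift-invariant
  where
  open ≡-Reasoning
  shift-invariant : take (length (ascents (y ∷ w))) (ascents (x ∷ y ∷ w)) ≡ ascents (y ∷ w)
  shift-invariant = begin
    take (length (ascents (y ∷ w))) (ascents (x ∷ y ∷ w))  ≡⟨ cong (λ m → take m (ascents (x ∷ y ∷ w))) (length-ascents y w) ⟩
    take (length w) (ascents (x ∷ y ∷ w))                  ≡⟨ ascents-take (length w) (x ∷ y ∷ w) ⟨
    ascents (take (suc (length w)) (x ∷ y ∷ w))            ≡⟨ ascents-red (take (suc (length w)) (x ∷ y ∷ w)) ⟨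
    ascents (red (take (suc (length w)) (x ∷ y ∷ w)))      ≡⟨ cong ascents loop ⟩
    ascents (red (y ∷ w))                                  ≡⟨ ascents-red (y ∷ w) ⟩
    ascents (y ∷ w)                                        ∎
... | true  | same = inj₁ (Linked⇒AllPairs <-trans (all-ascents⇒ascending (x ∷ y ∷ w) (eq ∷ same)))
... | false | same = inj₂ (Linked⇒AllPairs (λ p q → <-trans q p) (no-ascents⇒descending (x ∷ y ∷ w) u (eq ∷ same)))

-- Windows of a word

take-length-++ : ∀ {A : Set} (xs ys : List A) → take (length xs) (xs ++ ys) ≡ xs
take-length-++ []       ys = refl
take-length-++ (x ∷ xs) ys = cong (x ∷_) (take-length-++ xs ys)

tail-window : ∀ {A : Set} p j (us : List A) → drop 1 (take (suc p) (drop j us)) ≡ take p (drop (suc j) us)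
tail-window p       (suc j) (u ∷ us) = tail-window p j us
tail-window p       zero    (u ∷ us) = refl
tail-window zero    zero    []       = refl
tail-window (suc p) zero    []       = refl
tail-window zero    (suc j) []       = refl
tail-window (suc p) (suc j) []       = refl

init-window : ∀ {A : Set} p (us : List A) → take p (take (suc p) us) ≡ take p us
init-window p us = trans (take-take p (suc p) us) (cong (λ m → take m us) (m≤n⇒m⊓n≡m (n≤1+n p)))

length-take-≤ : ∀ {A : Set} {m} (w : List A) → m ≤ length w → length (take m w) ≡ m
length-take-≤ {m = m} w m≤ = trans (length-take m w) (m≤n⇒m⊓n≡m m≤)

length-window : ∀ {A : Set} n j (us : List A) → j + n ≤ length us → length (take n (drop j us)) ≡ n
length-window n j us j+n≤ = length-take-≤ (drop j us)
  (subst (n ≤_) (sym (length-drop j us)) (m+n≤o⇒m≤o∸n n (subst (_≤ length us) (+-comm j n) j+n≤)))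

-- Necessity

module Necessity {p a b : ℕ} (1≤a : 1 ≤ a) (a<b : a < b) (b≤n : b ≤ suc p)
                 {us σ : List ℕ} (word : IsUPWord (suc p) a b us)
                 (σ-perm : IsPermutation p σ) (start : red (take p us) ≡ σ) where

  open IsUPWord word

  n : ℕ
  n = suc p

  Position : ℕ → List ℕ → Set
  Position i π = IsFactorPosition n us i × Covers (factor n a b us i) π

  position-unique : ∀ {π i j} → IsPermutation n π → Position i π → Position j π → i ≡ j
  position-unique {π} π-perm i-pos j-pos with _ , _ , unique ← covering π π-perm =
    trans (sym (unique i-pos)) (unique j-pos)

  -- An edge covered by the wildcard enters σ. If it also leaves σ it is a loop, hence monotone, and
  -- begins with 1 or `n`; since `1 ≤ a < b ≤ n`, only `a` can be 1 and only `b` can be `n`.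
  wildcard-loop : ∀ {π} → IsPermutation n π → red (take p π) ≡ σ → Position 0 π →
                  (a ≡ 1 × σ ≡ increasing p) ⊎ (b ≡ n × σ ≡ decreasing p)
  wildcard-loop {[]}    π-perm src (_ , ())
  wildcard-loop {x ∷ π} π-perm src (_ , x≡ab , tgt) = monotone
    (loop-monotone (x ∷ π) (perm-unique π-perm) (trans (cong (λ m → red (take m (x ∷ π))) |π|≡p) (trans src (sym tgt′))))
    where
    |π|≡p : length π ≡ p
    |π|≡p = suc-injective (perm-length π-perm)
    tgt′ : red π ≡ σ
    tgt′ = trans tgt start
    monotone : AllPairs _<_ (x ∷ π) ⊎ AllPairs (flip _<_) (x ∷ π) →
               (a ≡ 1 × σ ≡ increasing p) ⊎ (b ≡ n × σ ≡ decreasing p)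
    monotone (inj₁ up@(_ ∷ π↑)) = inj₁ (a≡1 x≡ab , trans (sym tgt′) (trans (red-ascending π↑) (cong increasing |π|≡p)))
      where
      x≡1 : x ≡ 1
      x≡1 = ∷-injectiveˡ (trans (sym (red-of-perm π-perm)) (red-ascending up))
      a≡1 : x ≡ a ⊎ x ≡ b → a ≡ 1
      a≡1 (inj₁ x≡a) = trans (sym x≡a) x≡1
      a≡1 (inj₂ x≡b) = contradiction (subst (a <_) (trans (sym x≡b) x≡1) a<b) (≤⇒≯ 1≤a)
    monotone (inj₂ down@(_ ∷ π↓)) = inj₂ (b≡n x≡ab , trans (sym tgt′) (trans (red-descending π↓) (cong decreasing |π|≡p)))
      where
      x≡n : x ≡ n
      x≡n = trans (∷-injectiveˡ (trans (sym (red-of-perm π-perm)) (red-descending down))) (cong suc |π|≡p)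
      b≡n : x ≡ a ⊎ x ≡ b → b ≡ n
      b≡n (inj₁ x≡a) = contradiction (<-≤-trans a<b b≤n) (<-irrefl (trans (sym x≡a) x≡n))
      b≡n (inj₂ x≡b) = trans (sym x≡b) x≡n

  out-edge : Fin n → List ℕ
  out-edge k = append (suc (toℕ k)) σ

  out-edge-perm : ∀ k → IsPermutation n (out-edge k)
  out-edge-perm k = append-perm σ-perm (s≤s z≤n) (toℕ<n k)

  out-edge-source : ∀ k → red (take p (out-edge k)) ≡ σ
  out-edge-source k = trans (cong red init≡) (trans (red-map-mono (shift (suc (toℕ k))) (shift-mono-< _) σ) (red-of-perm σ-perm))
    where
    shifted = map (shift (suc (toℕ k))) σ
    init≡ : take p (out-edge k) ≡ shifted
    init≡ = trans (cong (λ m → take m (out-edge k)) (sym (trans (length-map _ σ) (perm-length σ-perm))))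
                  (take-length-++ shifted _)

  out-edge-injective : ∀ {k l} → out-edge k ≡ out-edge l → k ≡ l
  out-edge-injective eq = toℕ-injective (suc-injective (∷ʳ-injectiveʳ _ _ eq))

  position : Fin n → ℕ
  position k = proj₁ (covering (out-edge k) (out-edge-perm k))

  position-covers : ∀ k → Position (position k) (out-edge k)
  position-covers k = proj₁ (proj₂ (covering (out-edge k) (out-edge-perm k)))

  -- x is the first letter of the n-permutation that enters the occurrence of σ
  -- at position i; the occurrence at position 1, entered from the wildcard, gets a.
  data Enters (x : ℕ) : ℕ → Set where
    first : x ≡ a → Enters x 1
    later : ∀ j → x ≢ a → IsFactorPosition n us (suc j) →
            prepend x σ ≡ red (take n (drop j us)) → Enters x (2 + j)

  -- An edge leaving σ at position `i` begins with an occurrence of σ. From position 2 on, the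
  -- preceding factor is an edge into σ, and its first letter is the witness.
  entering : ∀ i {k} → i ≢ 0 → Position i (out-edge k) →
             ∃[ x ] (Enters (suc (toℕ {n} x)) i × suc (toℕ x) ≢ b)
  entering zero          i≢0 _ = contradiction refl i≢0
  entering (suc zero)    _   _ =
    fromℕ< a-1<n , first eq , λ eq′ → <⇒≢ a<b (trans (sym eq) eq′)
    where
    a-1<n : a ∸ 1 < n
    a-1<n = <-≤-trans (≤-<-trans (m∸n≤m a 1) a<b) b≤n
    eq : suc (toℕ (fromℕ< a-1<n)) ≡ a
    eq = trans (cong suc (toℕ-fromℕ< a-1<n)) (m+[n∸m]≡n 1≤a)
  entering (suc (suc j)) {k} _ (valid , covers) = build (red w) refl
    where
    w = take n (drop j us)
    valid′ : IsFactorPosition n us (suc j)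
    valid′ = ≤-trans (n≤1+n _) valid
    w-length : length w ≡ n
    w-length = length-window n j us (≤-pred valid′)
    red-w-perm : IsPermutation n (red w)
    red-w-perm = subst (λ m → IsPermutation m (red w)) w-length (red-perm w (distinct (suc j) valid′))
    target : red (drop 1 (red w)) ≡ σ
    target = begin
      red (drop 1 (red w))                          ≡⟨ red-tail-red w ⟩
      red (drop 1 w)                                ≡⟨ cong red (tail-window p j us) ⟩
      red (take p (drop (suc j) us))                ≡⟨ cong red (init-window p (drop (suc j) us)) ⟨
      red (take p (take n (drop (suc j) us)))       ≡⟨ red-take-red p (take n (drop (suc j) us)) ⟨
      red (take p (red (take n (drop (suc j) us)))) ≡⟨ cong (red ∘ take p) covers ⟨
      red (take p (out-edge k))                     ≡⟨ out-edge-source k ⟩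
      σ                                             ∎
      where open ≡-Reasoning
    -- With first letter `a` or `b`, this edge into σ would also be covered at position 0.
    not-wildcard : ∀ {x π} → red w ≡ x ∷ π → ¬ (x ≡ a ⊎ x ≡ b)
    not-wildcard {x} {π} eq x≡ab = contradiction
      (position-unique (subst (IsPermutation n) eq red-w-perm) (valid′ , sym eq)
         (long , x≡ab , trans (cong (red ∘ drop 1) (sym eq)) (trans target (sym start))))
      λ ()
    build : ∀ ρ → red w ≡ ρ → ∃[ x ] (Enters (suc (toℕ {n} x)) (2 + j) × suc (toℕ x) ≢ b)
    build []          eq = contradiction (trans (sym (perm-length red-w-perm)) (cong length eq)) λ ()
    build (zero ∷ π)  eq = contradiction (proj₁ (∈-perm⁻ (subst (IsPermutation n) eq red-w-perm) (here refl))) λ ()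
    build (suc x ∷ π) eq = fromℕ< x<n
      , subst (λ y → Enters (suc y) (2 + j)) (sym (toℕ-fromℕ< x<n)) (later j (not-wildcard eq ∘ inj₁) valid′ edge)
      , λ x≡b → not-wildcard eq (inj₂ (trans (cong suc (sym (toℕ-fromℕ< x<n))) x≡b))
      where
      xπ-perm : IsPermutation n (suc x ∷ π)
      xπ-perm = subst (IsPermutation n) eq red-w-perm
      x<n : x < n
      x<n = proj₂ (∈-perm⁻ xπ-perm (here refl))
      edge : prepend (suc x) σ ≡ red w
      edge = trans (cong (prepend (suc x)) (trans (sym target) (cong (red ∘ drop 1) eq)))
                   (trans (sym (proj₁ (perm-uncons xπ-perm))) (sym eq))

  enters-injective : ∀ {x i j} → 1 ≤ x → x ≤ n → Enters x i → Enters x j → i ≡ j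
  enters-injective _   _   (first _)         (first _)         = refl
  enters-injective _   _   (first x≡a)       (later _ x≢a _ _) = contradiction x≡a x≢a
  enters-injective _   _   (later _ x≢a _ _) (first x≡a)       = contradiction x≡a x≢a
  enters-injective 1≤x x≤n (later i _ i-valid i-edge) (later j _ j-valid j-edge) =
    cong suc (position-unique (prepend-perm σ-perm 1≤x x≤n) (i-valid , i-edge) (j-valid , j-edge))

  -- A factor without the wildcard covers a single permutation.
  position-injective : ∀ {k l} → position k ≢ 0 → position k ≡ position l → k ≡ l
  position-injective {k} {l} k≢0 eq = out-edge-injective
    (plain-covers (position k) k≢0 (position-covers k) (subst (λ i → Position i (out-edge l)) (sym eq) (position-covers l)))
    where
    plain-covers : ∀ i {π ρ} → i ≢ 0 → Position i π → Position i ρ → π ≡ ρ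
    plain-covers zero    i≢0 _       _       = contradiction refl i≢0
    plain-covers (suc i) _   (_ , π≡) (_ , ρ≡) = trans π≡ (sym ρ≡)

  necessity : (a ≡ 1 × σ ≡ increasing p) ⊎ (b ≡ n × σ ≡ decreasing p)
  necessity with any? (λ k → position k ≟ 0)
  ... | yes (k , k≡0) = wildcard-loop (out-edge-perm k) (out-edge-source k)
          (subst (λ i → Position i (out-edge k)) k≡0 (position-covers k))
  -- Otherwise each of the `n` edges leaving σ is assigned the letter by which σ was entered.
  -- Distinct edges get distinct letters and `b` never occurs, so `punchOut` gives an injection from
  -- `Fin n` to `Fin p`.
  ... | no  none = contradiction (injective⇒≤ injective) (<⇒≱ (n<1+n p))
    where
    enter : ∀ k → ∃[ x ] (Enters (suc (toℕ {n} x)) (position k) × suc (toℕ x) ≢ b)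
    enter k = entering (position k) (none ∘ (k ,_)) (position-covers k)
    b-1<n : b ∸ 1 < n
    b-1<n = ≤-trans (≤-reflexive (m+[n∸m]≡n (≤-trans 1≤a (<⇒≤ a<b)))) b≤n
    b′ : Fin n
    b′ = fromℕ< b-1<n
    b′≢ : ∀ k → b′ ≢ proj₁ (enter k)
    b′≢ k eq = proj₂ (proj₂ (enter k)) (trans (cong (suc ∘ toℕ) (sym eq))
      (trans (cong suc (toℕ-fromℕ< b-1<n)) (m+[n∸m]≡n (≤-trans 1≤a (<⇒≤ a<b)))))
    injective : ∀ {k l} → punchOut (b′≢ k) ≡ punchOut (b′≢ l) → k ≡ l
    injective {k} {l} eq = position-injective (none ∘ (k ,_)) (enters-injective (s≤s z≤n) (toℕ<n _)
      (proj₁ (proj₂ (enter k)))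
      (subst (λ x → Enters (suc (toℕ x)) (position l)) (sym (punchOut-injective (b′≢ k) (b′≢ l) eq)) (proj₁ (proj₂ (enter l)))))

-- The list of all n-permutations

_≟ʷ_ : DecidableEquality (List ℕ)
_≟ʷ_ = ≡-dec _≟_

open import Data.List.Membership.DecPropositional _≟ʷ_ using (_∈?_)

extract : ∀ {A : Set} {x : A} {xs} → x ∈ xs → ∃[ xs′ ] xs ↭ x ∷ xs′
extract {x = x} x∈xs with ys , zs , refl ← ∈-∃++ x∈xs = ys ++ zs , ↭-shift x ys zs

raw-permutations : ℕ → List (List ℕ)
raw-permutations zero    = [ [] ]
raw-permutations (suc n) = concatMap (λ v → map (λ k → prepend k v) (increasing (suc n))) (raw-permutations n)

-- Deduplication supplies `Unique` without a separate argument that different choices of letters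
-- yield different words.
permutations : ℕ → List (List ℕ)
permutations n = deduplicate _≟ʷ_ (raw-permutations n)

∈-permutations⁺ : ∀ n {π} → IsPermutation n π → π ∈ permutations n
∈-permutations⁺ n = ∈-deduplicate⁺ _≟ʷ_ ∘ raw n _
  where
  raw : ∀ n π → IsPermutation n π → π ∈ raw-permutations n
  raw zero    []      _      = here refl
  raw zero    (k ∷ π) π-perm = contradiction (perm-length π-perm) λ ()
  raw (suc n) []      π-perm = contradiction (perm-length π-perm) λ ()
  raw (suc n) (k ∷ π) π-perm with eq , tail-perm ← perm-uncons π-perm
    | 1≤k , k≤n ← ∈-perm⁻ π-perm (here refl) =
    subst (_∈ raw-permutations (suc n)) (sym eq)
      (∈-concatMap⁺ _ (lose (raw n (red π) tail-perm) (∈-map⁺ _ (∈-perm⁺ ↭-refl 1≤k k≤n))))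

∈-permutations⁻ : ∀ n {π} → π ∈ permutations n → IsPermutation n π
∈-permutations⁻ n = raw n ∘ ∈-deduplicate⁻ _≟ʷ_ (raw-permutations n)
  where
  raw : ∀ n {π} → π ∈ raw-permutations n → IsPermutation n π
  raw zero    (here refl) = ↭-refl
  raw (suc n) π∈ with find (∈-concatMap⁻ _ {xs = raw-permutations n} π∈)
  ... | v , v∈ , π∈′ with ∈-map⁻ _ π∈′
  ...   | k , k∈ , refl with 1≤k , k≤n ← ∈-perm⁻ ↭-refl k∈ = prepend-perm (raw n v∈) 1≤k k≤n

-- Rotation carries the edges entering a vertex to the edges leaving it; this is the source of the
-- balance of the whole graph.
rotate : List ℕ → List ℕ
rotate []      = []
rotate (x ∷ w) = w ∷ʳ x

rotate-↭ : ∀ w → w ↭ rotate w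
rotate-↭ []      = ↭-refl
rotate-↭ (x ∷ w) = ∷↭∷ʳ x w

rotate-injective : ∀ {v w} → rotate v ≡ rotate w → v ≡ w
rotate-injective {[]}    {[]}        _  = refl
rotate-injective {[]}    {_ ∷ []}    ()
rotate-injective {[]}    {_ ∷ _ ∷ _} ()
rotate-injective {_ ∷ []}    {[]}    ()
rotate-injective {_ ∷ _ ∷ _} {[]}    ()
rotate-injective {x ∷ v} {y ∷ w}     eq with refl , refl ← ∷ʳ-injective v w eq = refl

rotate-surjective : ∀ w → ∃[ v ] rotate v ≡ w
rotate-surjective w with initLast w
... | []      = [] , refl
... | v ∷ʳ′ x = x ∷ v , refl

-- Both lists are free of duplicates and have the same members, hence agree as bags.
rotate-permutations : ∀ n → map rotate (permutations n) ↭ permutations n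
rotate-permutations n = ∼bag⇒↭ (unique∧set⇒bag
  (Unique.map⁺ rotate-injective (deduplicate-! _≟ʷ_ _)) (deduplicate-! _≟ʷ_ _) (mk⇔ to from))
  where
  to : ∀ {π} → π ∈ map rotate (permutations n) → π ∈ permutations n
  to π∈ with ρ , ρ∈ , refl ← ∈-map⁻ rotate π∈ =
    ∈-permutations⁺ n (↭-trans (↭-sym (rotate-↭ ρ)) (∈-permutations⁻ n ρ∈))
  from : ∀ {π} → π ∈ permutations n → π ∈ map rotate (permutations n)
  from {π} π∈ with ρ , refl ← rotate-surjective π =
    ∈-map⁺ rotate (∈-permutations⁺ n (↭-trans (rotate-↭ ρ) (∈-permutations⁻ n π∈)))

-- Counting edges

δ : List ℕ → List ℕ → ℕ
δ x y = if does (x ≟ʷ y) then 1 else 0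

δ-≡ : ∀ {x y} → x ≡ y → δ x y ≡ 1
δ-≡ {x} {y} x≡y with x ≟ʷ y
... | yes _   = refl
... | no  x≢y = contradiction x≡y x≢y

δ-≢ : ∀ {x y} → x ≢ y → δ x y ≡ 0
δ-≢ {x} {y} x≢y with x ≟ʷ y
... | yes x≡y = contradiction x≡y x≢y
... | no  _   = refl

-- With `f` the source or target map, this is the out-degree or in-degree of `x` in the edge list
-- `U`.
count : (List ℕ → List ℕ) → List ℕ → List (List ℕ) → ℕ
count f x U = sum (map (λ e → δ (f e) x) U)

count-↭ : ∀ f x {U V} → U ↭ V → count f x U ≡ count f x V
count-↭ f x U↭V = sum-↭ (map⁺ (λ e → δ (f e) x) U↭V)

count≡0⁺ : ∀ f x U → (∀ {e} → e ∈ U → f e ≢ x) → count f x U ≡ 0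
count≡0⁺ f x []      none = refl
count≡0⁺ f x (e ∷ U) none = cong₂ _+_ (δ-≢ (none (here refl))) (count≡0⁺ f x U (none ∘ there))

count≡0⁻ : ∀ f x {U e} → count f x U ≡ 0 → e ∈ U → f e ≢ x
count≡0⁻ f x {e ∷ U} eq (here refl) fe≡x = contradiction (trans (sym (δ-≡ fe≡x)) (m+n≡0⇒m≡0 _ eq)) λ ()
count≡0⁻ f x {d ∷ U} eq (there e∈U)      = count≡0⁻ f x (m+n≡0⇒n≡0 (δ (f d) x) eq) e∈U

-- Letters of prescribed rank

rank-suc-∉ : ∀ {m} w → All (_≢ m) w → rank w (suc m) ≡ rank w m
rank-suc-∉ {m} []      _           = refl
rank-suc-∉ {m} (y ∷ w) (y≢m ∷ w≢m) with y <? m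
... | yes y<m = trans (rank-∷-< w (m<n⇒m<1+n y<m)) (trans (cong suc (rank-suc-∉ w w≢m)) (sym (rank-∷-< w y<m)))
... | no  y≮m = trans (rank-∷-≮ w λ y<1+m → y≮m (≤∧≢⇒< (≤-pred y<1+m) y≢m)) (trans (rank-suc-∉ w w≢m) (sym (rank-∷-≮ w y≮m)))

-- Raising the threshold from `m` to `suc m` newly counts only the letter `m`, which occurs once.
rank-suc-∈ : ∀ {m w} → Unique w → m ∈ w → rank w (suc m) ≡ suc (rank w m)
rank-suc-∈ {m} {_ ∷ w} (m∉w ∷ _) (here refl) =
  trans (rank-∷-< w (n<1+n m)) (cong suc (trans (rank-suc-∉ w (All.map (_∘ sym) m∉w)) (sym (rank-∷-≮ w (<-irrefl refl)))))
rank-suc-∈ {m} {y ∷ w} (y∉w ∷ w-unique) (there m∈w) with y <? m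
... | yes y<m = trans (rank-∷-< w (m<n⇒m<1+n y<m)) (trans (cong suc (rank-suc-∈ w-unique m∈w)) (cong suc (sym (rank-∷-< w y<m))))
... | no  y≮m = trans (rank-∷-≮ w λ y<1+m → y≮m (≤∧≢⇒< (≤-pred y<1+m) (All.lookup y∉w m∈w)))
                      (trans (rank-suc-∈ w-unique m∈w) (cong suc (sym (rank-∷-≮ w y≮m))))

double : ℕ → ℕ
double x = x + x

double-mono-< : ∀ {x y} → x < y → double x < double y
double-mono-< x<y = +-mono-< x<y x<y

double-injective : ∀ {x y} → double x ≡ double y → x ≡ y
double-injective {x} {y} eq = ≤-antisym (≮⇒≥ λ y<x → <-irrefl (sym eq) (double-mono-< y<x))
                                        (≮⇒≥ λ x<y → <-irrefl eq (double-mono-< x<y))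

odd≢double : ∀ m x → suc (double m) ≢ double x
odd≢double m (suc x) eq = odd≢double x m (trans (sym (+-suc x x)) (suc-injective (sym eq)))

odd-<-double : ∀ {m y} → y ≤ m → double y < suc (double m)
odd-<-double y≤m = s≤s (+-mono-≤ y≤m y≤m)

rank-double : ∀ m w → rank (map double w) (suc (double m)) ≡ rank w (suc m)
rank-double m []      = refl
rank-double m (y ∷ w) with y <? suc m
... | yes y≤m = trans (rank-∷-< (map double w) (odd-<-double (≤-pred y≤m)))
                      (trans (cong suc (rank-double m w)) (sym (rank-∷-< w y≤m)))
... | no  y≰m = trans (rank-∷-≮ (map double w) (≤⇒≯ (double-mono-< (≰⇒> (y≰m ∘ s≤s)))))
                      (trans (rank-double m w) (sym (rank-∷-≮ w y≰m)))

-- For rank 1 the letter 1 lies below every doubled positive letter. For a larger `k`, let `m` be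
-- the letter of rank `k - 1` in `w`; then `2m + 1` comes directly after its double.
insert-odd : ∀ {p w k} → All (1 ≤_) w → Unique w → IsPermutation p (red w) → 1 ≤ k → k ≤ suc p →
             ∃[ m ] rank (map double w) (suc (double m)) ≡ k
insert-odd {w = w} {suc zero} w-positive _ _ _ _ =
  0 , rank-minimum (All.map⁺ (All.map (λ 1≤y → +-mono-≤ 1≤y 1≤y) w-positive))
insert-odd {w = w} {suc (suc k)} _ w-unique red-perm _ (s≤s k≤p)
  with ∈-map⁻ (rank w) (∈-perm⁺ red-perm (s≤s z≤n) k≤p)
... | m , m∈w , eq = m , trans (rank-double m w) (trans (rank-suc-∈ w-unique m∈w) (cong suc (sym eq)))

-- Sufficiency

module Sufficiency
  {p ℓ c : ℕ} (1≤ℓ : 1 ≤ ℓ) (ℓ≤n : ℓ ≤ suc p) (1≤c : 1 ≤ c) (c≤n : c ≤ suc p) (ℓ≢c : ℓ ≢ c)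
  {σ : List ℕ} (σ-perm : IsPermutation p σ)
  (loop : red (take p (prepend ℓ σ)) ≡ σ)
  -- Reachability as an induction principle: a property of σ that passes from the source of each
  -- edge ℓv to its target `v` holds at every vertex.
  (reach : (Q : List ℕ → Set) → Q σ →
           (∀ {v} → IsPermutation p v → Q (red (take p (prepend ℓ v))) → Q v) →
           ∀ {v} → IsPermutation p v → Q v)
  where

  n : ℕ
  n = suc p

  source target : List ℕ → List ℕ
  source e = red (take p e)
  target e = red (drop 1 e)

  target-perm : ∀ {e} → IsPermutation n e → IsPermutation p (target e)
  target-perm {[]}    e-perm = contradiction (perm-length e-perm) λ ()
  target-perm {_ ∷ _} e-perm = proj₂ (perm-uncons e-perm)

  source-perm : ∀ {e} → IsPermutation n e → IsPermutation p (source e)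
  source-perm {e} e-perm = subst (λ m → IsPermutation m (source e))
    (length-take-≤ e (subst (p ≤_) (sym (perm-length e-perm)) (n≤1+n p)))
    (red-perm (take p e) (AllPairs.take⁺ p (perm-unique e-perm)))

  target-prepend : ∀ k {v} → IsPermutation p v → target (prepend k v) ≡ v
  target-prepend k = red-tail-prepend k

  prepend-target : ∀ {e v} → IsPermutation n e → target e ≡ v → ∃[ k ] (e ≡ prepend k v × 1 ≤ k × k ≤ n)
  prepend-target {[]}    e-perm _    = contradiction (perm-length e-perm) λ ()
  prepend-target {k ∷ π} e-perm refl = k , proj₁ (perm-uncons e-perm) , ∈-perm⁻ e-perm (here refl)

  -- The two edges reserved for the wildcard: the loop at σ and the other removed edge into σ.
  e₁ e₂ : List ℕ
  e₁ = prepend ℓ σ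
  e₂ = prepend c σ

  e₁-perm : IsPermutation n e₁
  e₁-perm = prepend-perm σ-perm 1≤ℓ ℓ≤n

  e₂-perm : IsPermutation n e₂
  e₂-perm = prepend-perm σ-perm 1≤c c≤n

  -- U is the set of edges not yet used by a walk from v to σ, built backwards.
  record Trail (v : List ℕ) (U : List (List ℕ)) : Set where
    field
      v-perm  : IsPermutation p v
      unique  : Unique U
      perms   : ∀ {e} → e ∈ U → IsPermutation n e
      balance : ∀ x → count source x U + δ v x ≡ count target x U + δ σ x

  -- The entering edge with first letter ℓ is the last one to be traversed at every
  -- vertex other than σ.
  Lazy : List (List ℕ) → Set
  Lazy U = ∀ {y} → IsPermutation p y → y ≢ σ → prepend ℓ y ∉ U → ∀ {e} → e ∈ U → target e ≢ y

  initial-trail : Trail σ (permutations n)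
  initial-trail = record
    { v-perm  = σ-perm
    ; unique  = deduplicate-! _≟ʷ_ (raw-permutations n)
    ; perms   = ∈-permutations⁻ n
    ; balance = λ x → cong (_+ δ σ x) (in≡out x)
    }
    where
    source-rotate : ∀ {e} → IsPermutation n e → source (rotate e) ≡ target e
    source-rotate {[]}    e-perm = contradiction (perm-length e-perm) λ ()
    source-rotate {k ∷ π} e-perm = cong red
      (trans (cong (λ m → take m (π ∷ʳ k)) (sym (suc-injective (perm-length e-perm)))) (take-length-++ π [ k ]))
    -- Rotation is a bijection from the edges entering x to the edges leaving x.
    in≡out : ∀ x → count source x (permutations n) ≡ count target x (permutations n)
    in≡out x = begin
      count source x (permutations n)                ≡⟨ count-↭ source x (↭-sym (rotate-permutations n)) ⟩
      count source x (map rotate (permutations n))   ≡⟨ cong sum (map-∘ (permutations n)) ⟨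
      count (source ∘ rotate) x (permutations n)     ≡⟨ cong sum (map-cong-local (All.tabulate λ e∈ →
                                                          cong (λ v → δ v x) (source-rotate (∈-permutations⁻ n e∈)))) ⟩
      count target x (permutations n)                ∎
      where open ≡-Reasoning

  extend-trail : ∀ {v U U′ e} → U ↭ e ∷ U′ → target e ≡ v → Trail v U → Trail (source e) U′
  extend-trail {v} {U} {U′} {e} U↭ refl trail = record
    { v-perm  = source-perm (perms (∈-resp-↭ (↭-sym U↭) (here refl)))
    ; unique  = AllPairs.tail (Unique-resp-↭ U↭ unique)
    ; perms   = perms ∘ ∈-resp-↭ (↭-sym U↭) ∘ there
    -- Adding `δ v x` on both sides restores `e` to both counts: its source is the new endpoint and
    -- its target is `v`.
    ; balance = λ x → +-cancelˡ-≡ (δ v x) _ _ (begin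
        δ v x + (count source x U′ + δ (source e) x)  ≡⟨ cong (δ v x +_) (+-comm (count source x U′) _) ⟩
        δ v x + count source x (e ∷ U′)               ≡⟨ +-comm (δ v x) _ ⟩
        count source x (e ∷ U′) + δ v x               ≡⟨ cong (_+ δ v x) (count-↭ source x U↭) ⟨
        count source x U + δ v x                      ≡⟨ balance x ⟩
        count target x U + δ σ x                      ≡⟨ cong (_+ δ σ x) (count-↭ target x U↭) ⟩
        (δ v x + count target x U′) + δ σ x           ≡⟨ +-assoc (δ v x) _ _ ⟩
        δ v x + (count target x U′ + δ σ x)           ∎)
    }
    where
    open Trail trail
    open ≡-Reasoning

  extend-lazy : ∀ {U U′ e} → U ↭ e ∷ U′ → Lazy U →
                (∀ {y} → IsPermutation p y → y ≢ σ → prepend ℓ y ≡ e → ∀ {d} → d ∈ U′ → target d ≢ y) → Lazy U′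
  extend-lazy {e = e} U↭ lazy last {y} y-perm y≢σ ℓy∉U′ d∈U′ with prepend ℓ y ≟ʷ e
  ... | yes ℓy≡e = last y-perm y≢σ ℓy≡e d∈U′
  ... | no  ℓy≢e = lazy y-perm y≢σ ℓy∉U (∈-resp-↭ (↭-sym U↭) (there d∈U′))
    where
    ℓy∉U : prepend ℓ y ∉ _
    ℓy∉U ℓy∈U with ∈-resp-↭ U↭ ℓy∈U
    ... | here ℓy≡e   = ℓy≢e ℓy≡e
    ... | there ℓy∈U′ = ℓy∉U′ ℓy∈U′

  -- Words that spell a walk

  window : ℕ → List ℕ → List ℕ
  window i us = red (take n (drop i us))

  -- us spells the walk without its last edges e₁, e₂.
  record Realises (v : List ℕ) (U : List (List ℕ)) (us : List ℕ) : Set where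
    field
      positive  : All (1 ≤_) us
      distinct  : Unique us
      long      : p ≤ length us
      start     : red (take p us) ≡ v
      e₁∉U      : e₁ ∉ U
      e₂∉U      : e₂ ∉ U
      -- The last three fields say together that the windows list every used edge other than `e₁`
      -- and `e₂` exactly once.
      traversed : ∀ {e} → IsPermutation n e → e ∉ U →
                  (e ≡ e₁ ⊎ e ≡ e₂) ⊎ ∃[ i ] (i + n ≤ length us × e ≡ window i us)
      fresh     : ∀ {i} → i + n ≤ length us → window i us ∉ U × window i us ≢ e₁ × window i us ≢ e₂
      injective : ∀ {i j} → i + n ≤ length us → j + n ≤ length us → window i us ≡ window j us → i ≡ j

  -- Doubling leaves the reductions of all windows unchanged and frees the odd values. An odd letter
  -- of rank `k` relative to the first `p` letters makes the new first window equal to kv, which is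
  -- `e`.
  extend-word : ∀ {v U U′ e us} → U ↭ e ∷ U′ → target e ≡ v → Trail v U → Realises v U us →
                ∃[ us′ ] Realises (source e) U′ us′
  extend-word {v} {U} {U′} {e} {us} U↭ e→v trail real
    with prepend-target (Trail.perms trail (∈-resp-↭ (↭-sym U↭) (here refl))) e→v
  ... | k , e≡kv , 1≤k , k≤n
    with insert-odd (All.take⁺ p (Realises.positive real)) (AllPairs.take⁺ p (Realises.distinct real))
           (subst (IsPermutation p) (sym (Realises.start real)) (Trail.v-perm trail)) 1≤k k≤n
  ... | m , rank≡k = us′ , record
    { positive  = s≤s z≤n ∷ All.map⁺ (All.map (λ 1≤x → ≤-trans 1≤x (m≤m+n _ _)) positive)
    ; distinct  = us′-distinct
    ; long      = m≤n⇒m≤1+n (subst (p ≤_) (sym (length-map double us)) long)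
    ; start     = trans (cong red (sym (init-window p us′))) (trans (sym (red-take-red p (take n us′))) (cong source window-zero))
    ; e₁∉U      = e₁∉U ∘ U′⊆U
    ; e₂∉U      = e₂∉U ∘ U′⊆U
    ; traversed = traversed′
    ; fresh     = fresh′
    ; injective = injective′
    }
    where
    open Realises real
    open Trail trail using (unique)
    x : ℕ
    x = suc (double m)
    us′ : List ℕ
    us′ = x ∷ map double us
    us′-distinct : Unique us′
    us′-distinct = All.map⁺ (All.tabulate λ {y} _ → odd≢double m y) ∷ Unique.map⁺ double-injective distinct
    U′⊆U : ∀ {d} → d ∈ U′ → d ∈ U
    U′⊆U = ∈-resp-↭ (↭-sym U↭) ∘ there
    e∈U : e ∈ U
    e∈U = ∈-resp-↭ (↭-sym U↭) (here refl)
    e∉U′ : e ∉ U′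
    e∉U′ = Unique[x∷xs]⇒x∉xs (Unique-resp-↭ U↭ unique)
    window-zero : window 0 us′ ≡ e
    window-zero = begin
      red (x ∷ take p (map double us))                                        ≡⟨ red-∷ (AllPairs.take⁺ n us′-distinct) ⟩
      prepend (rank (take p (map double us)) x) (red (take p (map double us))) ≡⟨ cong (λ w → prepend (rank w x) (red w)) (take-map p us) ⟩
      prepend (rank (map double (take p us)) x) (red (map double (take p us))) ≡⟨ cong₂ prepend rank≡k
                                                                                      (trans (red-map-mono double double-mono-< (take p us)) start) ⟩
      prepend k v                                                             ≡⟨ e≡kv ⟨
      e                                                                       ∎
      where open ≡-Reasoning
    window-suc : ∀ i → window (suc i) us′ ≡ window i us
    window-suc i = begin
      red (take n (drop i (map double us)))  ≡⟨ cong (red ∘ take n) (drop-map i us) ⟩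
      red (take n (map double (drop i us)))  ≡⟨ cong red (take-map n (drop i us)) ⟩
      red (map double (take n (drop i us)))  ≡⟨ red-map-mono double double-mono-< (take n (drop i us)) ⟩
      red (take n (drop i us))               ∎
      where open ≡-Reasoning
    valid⁻ : ∀ {i} → suc i + n ≤ length us′ → i + n ≤ length us
    valid⁻ (s≤s i+n≤) = subst (_ ≤_) (length-map double us) i+n≤
    valid⁺ : ∀ {i} → i + n ≤ length us → suc i + n ≤ length us′
    valid⁺ i+n≤ = s≤s (subst (_ ≤_) (sym (length-map double us)) i+n≤)
    traversed′ : ∀ {d} → IsPermutation n d → d ∉ U′ →
                 (d ≡ e₁ ⊎ d ≡ e₂) ⊎ ∃[ i ] (i + n ≤ length us′ × d ≡ window i us′)
    traversed′ {d} d-perm d∉U′ with d ≟ʷ e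
    ... | yes d≡e = inj₂ (0 , s≤s (subst (p ≤_) (sym (length-map double us)) long) , trans d≡e (sym window-zero))
    ... | no  d≢e with traversed d-perm d∉U
      where
      d∉U : d ∉ U
      d∉U d∈U with ∈-resp-↭ U↭ d∈U
      ... | here d≡e   = d≢e d≡e
      ... | there d∈U′ = d∉U′ d∈U′
    ...   | inj₁ removed           = inj₁ removed
    ...   | inj₂ (i , valid , d≡) = inj₂ (suc i , valid⁺ valid , trans d≡ (sym (window-suc i)))
    fresh′ : ∀ {i} → i + n ≤ length us′ → window i us′ ∉ U′ × window i us′ ≢ e₁ × window i us′ ≢ e₂
    fresh′ {zero}  _ rewrite window-zero =
      e∉U′ , (λ e≡e₁ → e₁∉U (subst (_∈ U) e≡e₁ e∈U)) , (λ e≡e₂ → e₂∉U (subst (_∈ U) e≡e₂ e∈U))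
    fresh′ {suc i} valid with ∉U , ≢e₁ , ≢e₂ ← fresh (valid⁻ valid) rewrite window-suc i = ∉U ∘ U′⊆U , ≢e₁ , ≢e₂
    e≢window : ∀ {i} → suc i + n ≤ length us′ → window 0 us′ ≢ window (suc i) us′
    e≢window {i} valid eq = proj₁ (fresh (valid⁻ valid))
      (subst (_∈ U) (trans (sym window-zero) (trans eq (window-suc i))) e∈U)
    injective′ : ∀ {i j} → i + n ≤ length us′ → j + n ≤ length us′ → window i us′ ≡ window j us′ → i ≡ j
    injective′ {zero}  {zero}  _  _  _  = refl
    injective′ {zero}  {suc j} _  vj eq = contradiction eq (e≢window vj)
    injective′ {suc i} {zero}  vi _  eq = contradiction (sym eq) (e≢window vi)
    injective′ {suc i} {suc j} vi vj eq = cong suc (injective (valid⁻ vi) (valid⁻ vj)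
      (trans (sym (window-suc i)) (trans eq (window-suc j))))

  -- Running the backward walk

  record Stage (v : List ℕ) (U : List (List ℕ)) : Set where
    field
      {us}  : List ℕ
      trail : Trail v U
      lazy  : Lazy U
      real  : Realises v U us

  Exhausted : List (List ℕ) → List ℕ → Set
  Exhausted U y = ∀ {e} → e ∈ U → target e ≢ y

  -- At an exhausted vertex other than σ the balance would equate a positive number with 0.
  stuck⇒root : ∀ {v U} → Trail v U → Exhausted U v → v ≡ σ
  stuck⇒root {v} {U} trail stuck with v ≟ʷ σ
  ... | yes v≡σ = v≡σ
  ... | no  v≢σ = contradiction (begin
    1                         ≡⟨ δ-≡ {v} refl ⟨
    δ v v                     ≤⟨ m≤n+m (δ v v) _ ⟩
    count source v U + δ v v  ≡⟨ Trail.balance trail v ⟩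
    count target v U + δ σ v  ≡⟨ cong₂ _+_ (count≡0⁺ target v U stuck) (δ-≢ (v≢σ ∘ sym)) ⟩
    0                         ∎) λ ()
    where open ≤-Reasoning

  extend : ∀ {v U U′ e} → U ↭ e ∷ U′ → target e ≡ v → Stage v U →
           (∀ {y} → IsPermutation p y → prepend ℓ y ≡ e → Exhausted U′ y) → Stage (source e) U′
  extend U↭ e→v stage last = record
    { trail = extend-trail U↭ e→v trail
    ; lazy  = extend-lazy U↭ lazy λ y-perm _ → last y-perm
    ; real  = proj₂ (extend-word U↭ e→v trail real)
    }
    where open Stage stage

  advance : ∀ {v U} → Stage v U → (∃[ e ] ∃[ U′ ] (U ↭ e ∷ U′ × Stage (source e) U′)) ⊎ Exhausted U v
  advance {v} {U} stage
    with Any.any? (λ e → (target e ≟ʷ v) ×-dec ¬? (e ≟ʷ prepend ℓ v)) U | prepend ℓ v ∈? U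
  ... | yes found | _ with e , e∈U , e→v , e≢ℓv ← find found with U′ , U↭ ← extract e∈U =
    inj₁ (e , U′ , U↭ , extend U↭ e→v stage λ y-perm ℓy≡e _ _ → e≢ℓv (trans (sym ℓy≡e)
      (cong (prepend ℓ) (trans (sym (target-prepend ℓ y-perm)) (trans (cong target ℓy≡e) e→v)))))
  ... | no none | no ℓv∉U = inj₂ stuck
    where
    stuck : Exhausted U v
    stuck {e} e∈U e→v with e ≟ʷ prepend ℓ v
    ... | yes refl = ℓv∉U e∈U
    ... | no  e≢ℓv = none (lose e∈U (e→v , e≢ℓv))
  ... | no none | yes ℓv∈U with U′ , U↭ ← extract ℓv∈U = inj₁ (prepend ℓ v , U′ , U↭ , extend U↭ ℓv→v stage last)
    where
    open Stage stage
    ℓv→v : target (prepend ℓ v) ≡ v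
    ℓv→v = target-prepend ℓ (Trail.v-perm trail)
    last : ∀ {y} → IsPermutation p y → prepend ℓ y ≡ prepend ℓ v → Exhausted U′ y
    last y-perm ℓy≡ℓv {d} d∈U′ d→y = none (lose (∈-resp-↭ (↭-sym U↭) (there d∈U′))
      ( trans d→y (trans (sym (target-prepend ℓ y-perm)) (trans (cong target ℓy≡ℓv) ℓv→v))
      , λ d≡ℓv → Unique[x∷xs]⇒x∉xs (Unique-resp-↭ U↭ (Trail.unique trail)) (subst (_∈ U′) d≡ℓv d∈U′)))

  grow : ∀ m {v U} → length U ≤ m → Stage v U → ∃[ U′ ] (Stage σ U′ × Exhausted U′ σ)
  grow m {v} {U} |U|≤m stage with advance stage
  ... | inj₂ stuck = U , subst (λ y → Stage y U) v≡σ stage , subst (Exhausted U) v≡σ stuck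
    where
    v≡σ : v ≡ σ
    v≡σ = stuck⇒root (Stage.trail stage) stuck
  grow zero    |U|≤m _ | inj₁ (_ , _ , U↭ , _)      = contradiction (subst (_≤ 0) (↭-length U↭) |U|≤m) λ ()
  grow (suc m) |U|≤m _ | inj₁ (_ , _ , U↭ , stage′) = grow m (≤-pred (subst (_≤ suc m) (↭-length U↭) |U|≤m)) stage′

  -- Exhaustion spreads by `reach`: if the source of ℓv is exhausted, then ℓv has been used, and by
  -- laziness so has every edge into `v`.
  all-traversed : ∀ {U} → Trail σ U → Lazy U → Exhausted U σ → ∀ {e} → IsPermutation n e → e ∉ U
  all-traversed {U} trail lazy σ-exhausted e-perm e∈U =
    reach (Exhausted U) σ-exhausted step (target-perm e-perm) e∈U refl
    where
    no-exit : ∀ {y} → Exhausted U y → ∀ {e} → e ∈ U → source e ≢ y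
    no-exit {y} y-exhausted = count≡0⁻ source y
      (+-cancelʳ-≡ (δ σ y) _ _ (trans (Trail.balance trail y) (cong (_+ δ σ y) (count≡0⁺ target y U y-exhausted))))
    step : ∀ {v} → IsPermutation p v → Exhausted U (source (prepend ℓ v)) → Exhausted U v
    step {v} v-perm exhausted with v ≟ʷ σ
    ... | yes refl = σ-exhausted
    ... | no  v≢σ  = lazy v-perm v≢σ λ ℓv∈U → no-exit exhausted ℓv∈U refl

  -- The backward walk takes the loop `e₁` first, which returns to σ, and then `e₂`. Both enter σ,
  -- where laziness demands nothing. The initial word has only `p` letters and hence no window.
  first-stage : ∃[ U ] Stage (source e₂) U
  first-stage with U₁ , all↭ ← extract (∈-permutations⁺ n e₁-perm) = second (extract e₂∈U₁)
    where
    e₂≢e₁ : e₂ ≢ e₁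
    e₂≢e₁ eq = ℓ≢c (sym (∷-injectiveˡ eq))
    e₂∈U₁ : e₂ ∈ U₁
    e₂∈U₁ with ∈-resp-↭ all↭ (∈-permutations⁺ n e₂-perm)
    ... | here e₂≡e₁  = contradiction e₂≡e₁ e₂≢e₁
    ... | there e₂∈U₁ = e₂∈U₁
    trail₁ : Trail σ U₁
    trail₁ = subst (λ v → Trail v U₁) loop (extend-trail all↭ (target-prepend ℓ σ-perm) initial-trail)
    second : ∃[ U₂ ] U₁ ↭ e₂ ∷ U₂ → ∃[ U ] Stage (source e₂) U
    second (U₂ , U₁↭) = U₂ , record
      { us    = take p e₂
      ; trail = extend-trail U₁↭ (target-prepend c σ-perm) trail₁
      ; lazy  = extend-lazy U₁↭ (extend-lazy all↭ initial-lazy (not-into-σ ℓ)) (not-into-σ c)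
      ; real  = record
        { positive  = All.take⁺ p (All.tabulate (proj₁ ∘ ∈-perm⁻ e₂-perm))
        ; distinct  = AllPairs.take⁺ p (perm-unique e₂-perm)
        ; long      = ≤-reflexive (sym length≡p)
        ; start     = cong red (take-all p (take p e₂) (≤-reflexive length≡p))
        ; e₁∉U      = λ e₁∈U₂ → Unique[x∷xs]⇒x∉xs (Unique-resp-↭ all↭ (Trail.unique initial-trail))
                                  (∈-resp-↭ (↭-sym U₁↭) (there e₁∈U₂))
        ; e₂∉U      = Unique[x∷xs]⇒x∉xs (Unique-resp-↭ U₁↭ (Trail.unique trail₁))
        ; traversed = traversed
        ; fresh     = λ valid → contradiction valid (no-window _)
        ; injective = λ valid → contradiction valid (no-window _)
        }
      }
      where
      length≡p : length (take p e₂) ≡ p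
      length≡p = length-take-≤ e₂ (subst (p ≤_) (sym (perm-length e₂-perm)) (n≤1+n p))
      no-window : ∀ i → ¬ (i + n ≤ length (take p e₂))
      no-window i valid = <⇒≱ (n<1+n p) (subst (n ≤_) length≡p (m+n≤o⇒n≤o i valid))
      initial-lazy : Lazy (permutations n)
      initial-lazy y-perm _ ℓy∉ = contradiction (∈-permutations⁺ n (prepend-perm y-perm 1≤ℓ ℓ≤n)) ℓy∉
      not-into-σ : ∀ k {U : List (List ℕ)} {y} → IsPermutation p y → y ≢ σ → prepend ℓ y ≡ prepend k σ →
                   ∀ {d} → d ∈ U → target d ≢ y
      not-into-σ k y-perm y≢σ eq _ _ = y≢σ
        (trans (sym (target-prepend ℓ y-perm)) (trans (cong target eq) (target-prepend k σ-perm)))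
      traversed : ∀ {e} → IsPermutation n e → e ∉ U₂ →
                  (e ≡ e₁ ⊎ e ≡ e₂) ⊎ ∃[ i ] (i + n ≤ length (take p e₂) × e ≡ window i (take p e₂))
      traversed e-perm e∉U₂ with ∈-resp-↭ all↭ (∈-permutations⁺ n e-perm)
      ... | here e≡e₁  = inj₁ (inj₁ e≡e₁)
      ... | there e∈U₁ with ∈-resp-↭ U₁↭ e∈U₁
      ...   | here e≡e₂  = inj₁ (inj₂ e≡e₂)
      ...   | there e∈U₂ = contradiction e∈U₂ e∉U₂

  -- The two maps identify the unordered pairs of `a`, `b` and of `ℓ`, `c`, so that the loop letter
  -- may be either wildcard value.
  module _ {a b : ℕ} (ab⇒ℓc : ∀ {x} → x ≡ a ⊎ x ≡ b → x ≡ ℓ ⊎ x ≡ c)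
                     (ℓc⇒ab : ∀ {x} → x ≡ ℓ ⊎ x ≡ c → x ≡ a ⊎ x ≡ b) where

    up-word : ∀ {U} → Stage σ U → Exhausted U σ → ∃[ us ] (IsUPWord n a b us × red (take p us) ≡ σ)
    up-word {U} stage σ-exhausted = us , record
      { positive = positive
      ; long     = s≤s long
      ; distinct = λ { zero    _ → AllPairs.take⁺ p distinct
                     ; (suc i) _ → AllPairs.take⁺ n (AllPairs.drop⁺ i distinct) }
      ; covering = covering
      } , start
      where
      open Stage stage
      open Realises real
      wildcard⇒removed : ∀ {π} → IsPermutation n π → Covers (factor n a b us 0) π → π ≡ e₁ ⊎ π ≡ e₂
      wildcard⇒removed {[]}    _      ()
      wildcard⇒removed {x ∷ π} π-perm (x≡ab , tgt) = Sum.map into into (ab⇒ℓc x≡ab)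
        where
        into : ∀ {k} → x ≡ k → x ∷ π ≡ prepend k σ
        into refl = trans (proj₁ (perm-uncons π-perm)) (cong (prepend x) (trans tgt start))
      removed⇒wildcard : ∀ {π} → π ≡ e₁ ⊎ π ≡ e₂ → Covers (factor n a b us 0) π
      removed⇒wildcard (inj₁ refl) = ℓc⇒ab (inj₁ refl) , trans (target-prepend ℓ σ-perm) (sym start)
      removed⇒wildcard (inj₂ refl) = ℓc⇒ab (inj₂ refl) , trans (target-prepend c σ-perm) (sym start)
      not-removed : ∀ {i} → i + n ≤ length us → ¬ (window i us ≡ e₁ ⊎ window i us ≡ e₂)
      not-removed valid = [ proj₁ (proj₂ (fresh valid)) , proj₂ (proj₂ (fresh valid)) ]′
      covering : ∀ π → IsPermutation n π →
                 ∃[ i ] ((IsFactorPosition n us i × Covers (factor n a b us i) π) ×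
                         (∀ {j} → IsFactorPosition n us j × Covers (factor n a b us j) π → i ≡ j))
      covering π π-perm with traversed π-perm (all-traversed trail lazy σ-exhausted π-perm)
      ... | inj₁ removed = 0 , (s≤s long , removed⇒wildcard removed) , unique
        where
        unique : ∀ {j} → IsFactorPosition n us j × Covers (factor n a b us j) π → 0 ≡ j
        unique {zero}  _             = refl
        unique {suc j} (s≤s valid , refl) = contradiction removed (not-removed valid)
      ... | inj₂ (i , valid , refl) = suc i , (s≤s valid , refl) , unique
        where
        unique : ∀ {j} → IsFactorPosition n us j × Covers (factor n a b us j) π → suc i ≡ j
        unique {zero}  (_ , covers)        = contradiction (wildcard⇒removed π-perm covers) (not-removed valid)
        unique {suc j} (s≤s valid′ , eq) = cong suc (injective valid valid′ eq)

    sufficiency : ∃[ us ] (IsUPWord n a b us × red (take p us) ≡ σ)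
    sufficiency =
      let _ , stage₀ = first-stage
          _ , stage , σ-exhausted = grow _ ≤-refl stage₀
      in up-word stage σ-exhausted

-- Reaching every vertex from a monotone one

-- Each letter of `ys` is extremal among the letters after it, so the window beginning there is an
-- edge ℓv. Going through `ys` from left to right, `Q` passes from each window of length `p` to the
-- next.
reach-by-prepending : ∀ {p ℓ} {R : ℕ → ℕ → Set} → (∀ {x y} → R x y → x ≢ y) →
  (∀ {x w} → length w ≡ p → All (R x) w → rank w x ≡ ℓ) →
  (Q : List ℕ → Set) → (∀ {v} → IsPermutation p v → Q (red (take p (prepend ℓ v))) → Q v) →
  ∀ {ys w} → AllPairs R ys → All (λ y → All (R y) w) ys → Unique w → p ≤ length w →
  Q (red (take p (ys ++ w))) → Q (red (take p w))
reach-by-prepending R⇒≢ R⇒rank Q step []           []           w-unique p≤ q = q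
reach-by-prepending {p} {ℓ} {R} R⇒≢ R⇒rank Q step {y ∷ ys} {w} (yRys ∷ ysR) (yRw ∷ ysRw) w-unique p≤ q =
  reach-by-prepending R⇒≢ R⇒rank Q step ysR ysRw w-unique p≤
    (step v-perm (subst Q (trans (cong red (sym (init-window p (y ∷ ys ++ w))))
                                 (trans (sym (red-take-red p (y ∷ v))) (cong (red ∘ take p) edge))) q))
  where
  v : List ℕ
  v = take p (ys ++ w)
  v-length : length v ≡ p
  v-length = length-take-≤ (ys ++ w)
    (subst (p ≤_) (sym (length-++ ys)) (≤-trans p≤ (m≤n+m (length w) (length ys))))
  yRv : All (R y) v
  yRv = All.take⁺ p (All.++⁺ yRys yRw)
  v-unique : Unique v
  v-unique = AllPairs.take⁺ p (AllPairs.++⁺ (AllPairs.map R⇒≢ ysR) w-unique (All.map (All.map R⇒≢) ysRw))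
  v-perm : IsPermutation p (red v)
  v-perm = subst (λ m → IsPermutation m (red v)) v-length (red-perm v v-unique)
  edge : red (y ∷ v) ≡ prepend ℓ (red v)
  edge = trans (red-∷ (All.map R⇒≢ yRv ∷ v-unique)) (cong (λ k → prepend k (red v)) (R⇒rank v-length yRv))

increasing-↑ : ∀ n → AllPairs _<_ (increasing n)
increasing-↑ n = AllPairs.applyUpTo⁺₁ suc n λ i<j _ → s<s i<j

decreasing-↓ : ∀ n → AllPairs (flip _<_) (decreasing n)
decreasing-↓ n = AllPairs.applyDownFrom⁺₁ suc n λ j<i _ → s<s j<i

-- The letters of `v` are raised by `p` to make room for 1, ..., `p` in front; the resulting word
-- leads from the increasing vertex to `v`.
reach-from-increasing : ∀ p (Q : List ℕ → Set) → Q (increasing p) →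
  (∀ {v} → IsPermutation p v → Q (red (take p (prepend 1 v))) → Q v) → ∀ {v} → IsPermutation p v → Q v
reach-from-increasing p Q q step {v} v-perm = subst Q end
  (reach-by-prepending <⇒≢ (λ _ → rank-minimum) Q step (increasing-↑ p)
    (All.tabulate λ y∈ → All.map⁺ (All.tabulate λ z∈ → below y∈ z∈))
    (Unique.map⁺ (+-cancelˡ-≡ p _ _) (perm-unique v-perm))
    (≤-reflexive (sym |w|≡p)) (subst Q (sym begins) q))
  where
  w : List ℕ
  w = map (p +_) v
  |w|≡p : length w ≡ p
  |w|≡p = trans (length-map (p +_) v) (perm-length v-perm)
  below : ∀ {y z} → y ∈ increasing p → z ∈ v → y < p + z
  below y∈ z∈ = ≤-<-trans (proj₂ (∈-perm⁻ ↭-refl y∈)) (m<m+n p (proj₁ (∈-perm⁻ v-perm z∈)))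
  begins : red (take p (increasing p ++ w)) ≡ increasing p
  begins = trans (cong red (trans (cong (λ m → take m (increasing p ++ w)) (sym (length-applyUpTo suc p)))
                                  (take-length-++ (increasing p) w)))
                 (red-of-perm {p} ↭-refl)
  end : red (take p w) ≡ v
  end = trans (cong red (take-all p w (≤-reflexive |w|≡p)))
              (trans (red-map-mono (p +_) (+-monoʳ-< p) v) (red-of-perm v-perm))

-- Here the new letters must exceed those of `v`, so `2p`, ..., `p + 1` are placed in front of `v`
-- itself.
reach-from-decreasing : ∀ p (Q : List ℕ → Set) → Q (decreasing p) →
  (∀ {v} → IsPermutation p v → Q (red (take p (prepend (suc p) v))) → Q v) → ∀ {v} → IsPermutation p v → Q v
reach-from-decreasing p Q q step {v} v-perm = subst Q end
  (reach-by-prepending >⇒≢ (λ |w|≡p w<x → trans (rank-maximum w<x) (cong suc |w|≡p)) Q step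
    (AllPairs.map⁺ (AllPairs.map (+-monoʳ-< p) (decreasing-↓ p)))
    (All.map⁺ (All.applyDownFrom⁺₁ suc p λ _ → All.tabulate λ z∈ → ≤-<-trans (proj₂ (∈-perm⁻ v-perm z∈)) (m<m+n p z<s)))
    (perm-unique v-perm) (≤-reflexive (sym (perm-length v-perm))) (subst Q (sym begins) q))
  where
  ys : List ℕ
  ys = map (p +_) (decreasing p)
  |ys|≡p : length ys ≡ p
  |ys|≡p = trans (length-map (p +_) (decreasing p)) (length-applyDownFrom suc p)
  begins : red (take p (ys ++ v)) ≡ decreasing p
  begins = trans (cong red (trans (cong (λ m → take m (ys ++ v)) (sym |ys|≡p)) (take-length-++ ys v)))
    (trans (red-map-mono (p +_) (+-monoʳ-< p) (decreasing p))
      (trans (red-descending (decreasing-↓ p)) (cong decreasing (length-applyDownFrom suc p))))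
  end : red (take p v) ≡ v
  end = trans (cong red (take-all p v (≤-reflexive (perm-length v-perm)))) (red-of-perm v-perm)

increasing-loop : ∀ p → red (take p (prepend 1 (increasing p))) ≡ increasing p
increasing-loop p = begin
  red (take p (prepend 1 (increasing p)))         ≡⟨ cong (red ∘ take p) (prepend-1-increasing p) ⟩
  red (take p (increasing (suc p)))               ≡⟨ red-ascending (AllPairs.take⁺ p (increasing-↑ (suc p))) ⟩
  increasing (length (take p (increasing (suc p)))) ≡⟨ cong increasing (length-take-≤ (increasing (suc p))
                                                           (subst (p ≤_) (sym (length-applyUpTo suc (suc p))) (n≤1+n p))) ⟩
  increasing p                                    ∎
  where open ≡-Reasoning

decreasing-loop : ∀ p → red (take p (prepend (suc p) (decreasing p))) ≡ decreasing p
decreasing-loop p = begin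
  red (take p (prepend (suc p) (decreasing p)))   ≡⟨ cong (red ∘ take p) (prepend-decreasing p) ⟩
  red (take p (decreasing (suc p)))               ≡⟨ red-descending (AllPairs.take⁺ p (decreasing-↓ (suc p))) ⟩
  decreasing (length (take p (decreasing (suc p)))) ≡⟨ cong decreasing (length-take-≤ (decreasing (suc p))
                                                           (subst (p ≤_) (sym (length-applyDownFrom suc (suc p))) (n≤1+n p))) ⟩
  decreasing p                                    ∎
  where open ≡-Reasoning

theorem5 : (n : ℕ) → 2 ≤ n → (a b : ℕ) → 1 ≤ a → a < b → b ≤ n →
    (σ : List ℕ) → IsPermutation (n ∸ 1) σ →
    (∃[ us ] (IsUPWord n a b us × red (take (n ∸ 1) us) ≡ σ))
    ⇔ ((a ≡ 1 × σ ≡ increasing (n ∸ 1)) ⊎ (b ≡ n × σ ≡ decreasing (n ∸ 1)))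
theorem5 (suc p) _ a b 1≤a a<b b≤n σ σ-perm = mk⇔ to from
  where
  to : ∃[ us ] (IsUPWord (suc p) a b us × red (take p us) ≡ σ) →
       (a ≡ 1 × σ ≡ increasing p) ⊎ (b ≡ suc p × σ ≡ decreasing p)
  to (us , word , start) = Necessity.necessity 1≤a a<b b≤n word σ-perm start
  from : (a ≡ 1 × σ ≡ increasing p) ⊎ (b ≡ suc p × σ ≡ decreasing p) →
         ∃[ us ] (IsUPWord (suc p) a b us × red (take p us) ≡ σ)
  from (inj₁ (refl , refl)) = Sufficiency.sufficiency 1≤a (s≤s z≤n) (≤-trans 1≤a (<⇒≤ a<b)) b≤n (<⇒≢ a<b)
    σ-perm (increasing-loop p) (reach-from-increasing p) id id
  -- The loop letter is now `b` and the other edge begins with `a`, hence `swap`.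
  from (inj₂ (refl , refl)) = Sufficiency.sufficiency (s≤s z≤n) ≤-refl 1≤a (≤-trans (<⇒≤ a<b) b≤n) (>⇒≢ a<b)
    σ-perm (decreasing-loop p) (reach-from-decreasing p) swap swap
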